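{- Let $m,n\ge 1$ be integers and let $G=P_m\square P_n$ be a grid graph. Then $G$ is Hall-universal.
   Context: All graphs are finite and simple. For a finite set $V$, $\mathcal G(V)$ denotes the set of all finite simple undirected graphs with vertex set $V$, and $N_G(v)$ is the (open) neighborhood of $v$ in $G$. List coloring: for a graph $H$, a set of colors $S$ and $L:V(H)\to 2^S$, $H$ is $L$-colorable if there is a map $\varphi:V(H)\to S$ with $\varphi(v)\in L(v)$ for all $v$ and $\varphi(u)\ne\varphi(v)$ for every edge $uv\in E(H)$. For a subgraph $F$ of $H$ and $\sigma\in S$, $\alpha(F,L,\sigma)$ is the maximum size of an independent set $X\subseteq V(F)$ of $F$ with $\sigma\in L(v)$ for all $v\in X$. The pair $(H,L)$ satisfies Hall's condition if $|V(F)|\le\sum_{\sigma\in S}\alpha(F,L,\sigma)$ for every subgraph $F$ of $H$. Graphic lists: for $G,H\in\mathcal G(V)$, let $L(v)=N_G(v)$ for all $v\in V$ (with color set $S=V$). $H$ is $G$-colorable if $H$ is $L$-colorable, and $(H,G)$ satisfies Hall's condition if $(H,L)$ does. A graph $G\in\mathcal G(V)$ is Hall-universal if, for every $H\in\mathcal G(V)$ such that $(H,G)$ satisfies Hall's condition, $H$ is $G$-colorable. $P_m\square P_n$ is the Cartesian product of the paths on $m$ and $n$ vertices, i.e. the $m\times n$ grid graph. -}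

module Defs where

open import Data.Fin using (Fin; toℕ; remQuot)
open import Data.Fin.Properties using (all?) renaming (_≟_ to _≟ᶠ_)
open import Data.Fin.Subset using (Subset; inside; outside; _∈_; _⊆_; ∣_∣)
open import Data.Fin.Subset.Properties using (_∈?_; _⊆?_)
open import Data.List using (List; []; _∷_; _++_; map; filter)
open import Data.List.Extrema.Nat using (max)
open import Data.Nat using (ℕ; zero; suc; _*_; _≤_)
open import Data.Nat.Properties using (+-0-commutativeMonoid; 1+n≢n) renaming (_≟_ to _≟ℕ_)
open import Data.Product using (Σ-syntax; _×_; _,_)
open import Data.Sum using (_⊎_; inj₁; inj₂; swap)
open import Data.Vec using ([]; _∷_; tabulate)
open import Relation.Binary using (Rel; Symmetric; Irreflexive; Decidable)
open import Relation.Binary.PropositionalEquality using (_≡_; _≢_; refl; sym)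
open import Relation.Nullary using (¬_; Dec; does)
open import Relation.Nullary.Decidable using (_×-dec_; _⊎-dec_; _→-dec_; ¬?)
open import Level using (0ℓ)

open import Algebra.Properties.CommutativeMonoid.Sum +-0-commutativeMonoid using (sum)

-- A finite vertex set of size n is taken to be Fin n, so 𝒢(V) is Graph n.
record Graph (n : ℕ) : Set₁ where
  infix 4 _~_ _~?_
  field
    _~_      : Rel (Fin n) 0ℓ
    _~?_     : Decidable _~_
    ~-sym    : Symmetric _~_
    ~-irrefl : Irreflexive _≡_ _~_

neighborhood : ∀ {n} → Graph n → Fin n → Subset n
neighborhood G v = tabulate (λ u → does (v ~? u))
  where open Graph G

-- Subgraphs need not be induced or spanning.
record Subgraph {n : ℕ} (H : Graph n) : Set₁ where
  infix 4 _~_ _~?_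
  field
    vertices  : Subset n
    _~_       : Rel (Fin n) 0ℓ
    _~?_      : Decidable _~_
    ~-sym     : Symmetric _~_
    ~⇒H       : ∀ {u v} → u ~ v → Graph._~_ H u v
    endpoints : ∀ {u v} → u ~ v → u ∈ vertices × v ∈ vertices

-- List assignments L : V(H) → 2^S with colour set S = Fin s.
Lists : ℕ → ℕ → Set
Lists n s = Fin n → Subset s

Colorable : ∀ {n s} → Graph n → Lists n s → Set
Colorable {n} {s} H L =
  Σ[ φ ∈ (Fin n → Fin s) ] (∀ v → φ v ∈ L v) × (∀ u v → u ~ v → φ u ≢ φ v)
  where open Graph H

subsets : ∀ n → List (Subset n)
subsets zero    = [] ∷ []
subsets (suc n) = map (outside ∷_) (subsets n) ++ map (inside ∷_) (subsets n)

module _ {n : ℕ} {H : Graph n} (F : Subgraph H) where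
  open Subgraph F

  Independent : Subset n → Set
  Independent X = X ⊆ vertices × (∀ u v → u ∈ X → v ∈ X → ¬ u ~ v)

  independent? : ∀ X → Dec (Independent X)
  independent? X = (X ⊆? vertices) ×-dec
    all? λ u → all? λ v → (u ∈? X) →-dec ((v ∈? X) →-dec ¬? (u ~? v))

  AllAllow : ∀ {s} → Lists n s → Fin s → Subset n → Set
  AllAllow L σ X = ∀ v → v ∈ X → σ ∈ L v

  allAllow? : ∀ {s} (L : Lists n s) σ X → Dec (AllAllow L σ X)
  allAllow? L σ X = all? λ v → (v ∈? X) →-dec (σ ∈? L v)

  -- The default value 0 of max is harmless: the empty set always qualifies.
  α : ∀ {s} → Lists n s → Fin s → ℕ
  α L σ = max 0 (map ∣_∣ (filter (λ X → independent? X ×-dec allAllow? L σ X) (subsets n)))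

HallCondition : ∀ {n s} → Graph n → Lists n s → Set₁
HallCondition H L =
  ∀ (F : Subgraph H) → ∣ Subgraph.vertices F ∣ ≤ sum (α F L)

HallUniversal : ∀ {n} → Graph n → Set₁
HallUniversal {n} G =
  ∀ (H : Graph n) → HallCondition H (neighborhood G) → Colorable H (neighborhood G)

path : ∀ n → Graph n
path n = record
  { _~_      = λ i j → suc (toℕ i) ≡ toℕ j ⊎ suc (toℕ j) ≡ toℕ i
  ; _~?_     = λ i j → (suc (toℕ i) ≟ℕ toℕ j) ⊎-dec (suc (toℕ j) ≟ℕ toℕ i)
  ; ~-sym    = swap
  ; ~-irrefl = λ { refl (inj₁ e) → 1+n≢n e ; refl (inj₂ e) → 1+n≢n e }
  }

-- The vertex set Fin m × Fin n is identified with Fin (m * n) through the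
-- bijection remQuot.
infixr 7 _□_
_□_ : ∀ {m n} → Graph m → Graph n → Graph (m * n)
_□_ {m} {n} A B = record
  { _~_      = λ x y → Adj (remQuot n x) (remQuot n y)
  ; _~?_     = λ x y → adj? (remQuot n x) (remQuot n y)
  ; ~-sym    = λ { (inj₁ (e , b)) → inj₁ (sym e , B.~-sym b)
                 ; (inj₂ (e , a)) → inj₂ (sym e , A.~-sym a) }
  ; ~-irrefl = λ { refl (inj₁ (_ , b)) → B.~-irrefl refl b
                 ; refl (inj₂ (_ , a)) → A.~-irrefl refl a }
  }
  where
  module A = Graph A
  module B = Graph B

  Adj : Rel (Fin m × Fin n) 0ℓ
  Adj (i , j) (k , l) = (i ≡ k × j B.~ l) ⊎ (j ≡ l × i A.~ k)

  adj? : Decidable Adj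
  adj? (i , j) (k , l) = ((i ≟ᶠ k) ×-dec (j B.~? l)) ⊎-dec ((j ≟ᶠ l) ×-dec (i A.~? k))

{-# OPTIONS --safe #-}
module Submission where

-- Colour every cell of the grid G by one of its neighbours in G.  Such a
-- colouring is proper for every graph H as soon as it is injective, and if
-- exactly two cells u and v share a colour, it is proper when u and v are not
-- adjacent in H.
--
-- If the number of rows or of columns is even, the grid is tiled by dominoes,
-- and the map sending each cell to the other half of its domino is injective
-- (pairing-evenRows), so every H is G-colorable.
--
-- If both are odd, the chessboard colouring has one more even cell than odd
-- cells.  Apply Hall's condition to the subgraph F of H induced by the even
-- cells.  An even colour is available to no even cell, so it contributes 0.  If
-- every odd colour contributed at most 1, the sum would be at most the number
-- of odd cells, which is less than the number of vertices of F.  Hence some odd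
-- cell σ has two neighbours u and v that are not adjacent in H (hall-witness).
-- It remains to find a colouring in which only u and v share a colour, and this
-- comes from covering the grid by the three cells u, σ, v and dominoes:  u and v
-- receive the colour σ, σ receives u or v, and the halves of each domino receive
-- each other (pairing-odd).  After a transposition σ lies in an even row and an
-- odd column.  Then u, σ, v lie in a window of size 1 × 3, 3 × 3 or 5 × 3 for
-- which a covering is drawn explicitly, and the window can be chosen with an
-- even number of rows above and below it and of columns on either side, so that
-- the rest of the grid is covered by dominoes (frame).

open import Defs
open import Data.Bool using (Bool)
open import Data.Fin using (Fin; zero; suc; toℕ; pred; combine; remQuot)
open import Data.Fin.Patterns using (0F; 1F; 2F; 3F)
open import Data.Fin.Properties
  using (all?; any?; toℕ-injective; toℕ<n; suc-injective;
         combine-remQuot; remQuot-combine; toℕ-combine)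
  renaming (_≟_ to _≟ᶠ_)
open import Data.Fin.Subset using (Subset; inside; outside; _∈_; ∣_∣; ⁅_⁆)
open import Data.Fin.Subset.Properties
  using (_∈?_; nonempty?; Empty-unique; ∣⊥∣≡0; ∣⁅x⁆∣≡1; p⊆q⇒∣p∣≤∣q∣; x∈⁅x⁆)
open import Data.List.Extrema.Nat using (max<v⁺)
import Data.List.Relation.Unary.All as All
import Data.List.Relation.Unary.All.Properties as All
open import Data.Nat using (ℕ; zero; suc; _+_; _*_; _≤_; _≥_; z≤n; s≤s; parity)
open import Data.Nat.Properties
  using (+-suc; +-cancelʳ-≡; +-mono-≤; ≤-refl; ≤-reflexive; ≤-trans; n≤1+n; ≤⇒≯;
         +-0-commutativeMonoid)
  renaming (suc-injective to suc-injectiveℕ)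
open import Algebra.Properties.CommutativeMonoid.Sum +-0-commutativeMonoid using (sum)
open import Data.Parity as ℙ using (Parity; 0ℙ; 1ℙ; _⁻¹)
open import Data.Parity.Properties
  using (suc-homo-⁻¹; +-homo-+; *-homo-*; ⁻¹-selfInverse)
  renaming (_≟_ to _≟ℙ_)
open import Data.Product as Product using (∃; _×_; _,_; proj₁; proj₂; uncurry)
open import Data.Product.Properties using (≡-dec)
open import Data.Sum as Sum using (_⊎_; inj₁; inj₂)
open import Data.Vec using (Vec; []; _∷_; lookup; tabulate)
open import Data.Vec.Properties using ([]=⇒lookup; lookup⇒[]=; lookup∘tabulate)
open import Function using (_∘_)
open import Level using (0ℓ)
open import Relation.Binary using (Rel; Decidable; DecidableEquality)
open import Relation.Binary.PropositionalEquality
  using (_≡_; _≢_; refl; sym; trans; cong; cong₂; subst; subst₂; module ≡-Reasoning)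
open import Relation.Nullary using (Dec; yes; no; ¬_; contradiction)
open import Relation.Nullary.Decidable
  using (True; toWitness; dec-true; decidable-stable; _×-dec_; _⊎-dec_; _→-dec_; ¬?)

-- Cells and pairings

infix 4 _∼_ _—_ _—?_ _≟ᶜ_

_∼_ : ∀ {n} → Rel (Fin n) 0ℓ
_∼_ {n} = Graph._~_ (path n)

Cell : ℕ → ℕ → Set
Cell m n = Fin m × Fin n

-- Adjacency in the grid; for the graph path m □ path n, x ~ y is by definition
-- remQuot n x — remQuot n y.
_—_ : ∀ {m n} → Rel (Cell m n) 0ℓ
(i , j) — (k , l) = (i ≡ k × j ∼ l) ⊎ (j ≡ l × i ∼ k)

_—?_ : ∀ {m n} → Decidable (_—_ {m} {n})
_—?_ {m} {n} (i , j) (k , l) =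
  ((i ≟ᶠ k) ×-dec Graph._~?_ (path n) j l) ⊎-dec ((j ≟ᶠ l) ×-dec Graph._~?_ (path m) i k)

_≟ᶜ_ : ∀ {m n} → DecidableEquality (Cell m n)
_≟ᶜ_ = ≡-dec _≟ᶠ_ _≟ᶠ_

swap-— : ∀ {m n} {p q : Cell m n} → p — q → Product.swap p — Product.swap q
swap-— (inj₁ e) = inj₂ e
swap-— (inj₂ e) = inj₁ e

-- {x, y} = {u, v}, as a relation between x and y.
Only : ∀ {A : Set} → A → A → Rel A 0ℓ
Only u v x y = (x ≡ u × y ≡ v) ⊎ (x ≡ v × y ≡ u)

only? : ∀ {m n} (u v : Cell m n) → Decidable (Only u v)
only? u v x y = ((x ≟ᶜ u) ×-dec (y ≟ᶜ v)) ⊎-dec ((x ≟ᶜ v) ×-dec (y ≟ᶜ u))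

map-Only : ∀ {A B : Set} (f : A → B) {u v x y} → Only u v x y → Only (f u) (f v) (f x) (f y)
map-Only f = Sum.map (Product.map (cong f) (cong f)) (Product.map (cong f) (cong f))

-- A choice of a neighbour for every cell in which two distinct cells may have
-- the same partner only when they are related by Share.  It need not be an
-- involution.
record Pairing {m n} (Share : Rel (Cell m n) 0ℓ) : Set where
  field
    partner   : Cell m n → Cell m n
    adjacent  : ∀ p → p — partner p
    injective : ∀ p q → partner p ≡ partner q → p ≡ q ⊎ Share p q

open Pairing

weaken : ∀ {m n} {R S : Rel (Cell m n) 0ℓ} → (∀ {p q} → R p q → S p q) → Pairing R → Pairing S
weaken R⇒S P = record
  { partner   = partner P
  ; adjacent  = adjacent P
  ; injective = λ p q → Sum.map₂ R⇒S ∘ injective P p q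
  }

transpose : ∀ {m n} {R : Rel (Cell n m) 0ℓ} → Pairing R →
            Pairing {m} {n} (λ p q → R (Product.swap p) (Product.swap q))
transpose P = record
  { partner   = Product.swap ∘ partner P ∘ Product.swap
  ; adjacent  = λ p → swap-— (adjacent P (Product.swap p))
  ; injective = λ p q e → Sum.map₁ (cong Product.swap)
                  (injective P (Product.swap p) (Product.swap q) (cong Product.swap e))
  }

-- Windows in a path

-- An interval of w consecutive vertices of path n, starting at a, together with
-- a perfect matching of the vertices outside it.  The values of mate inside the
-- interval are irrelevant.
record Window (w n a : ℕ) : Set where
  field
    at     : Fin w → Fin n
    toℕ-at : ∀ k → toℕ (at k) ≡ toℕ k + a
    mate   : Fin n → Fin n

  Outside : Fin n → Set
  Outside i = ∀ k → at k ≢ i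

  field
    mate-∼          : ∀ {i} → Outside i → i ∼ mate i
    mate-outside    : ∀ {i} → Outside i → Outside (mate i)
    mate-involutive : ∀ {i} → Outside i → mate (mate i) ≡ i

  at-injective : ∀ {k l} → at k ≡ at l → k ≡ l
  at-injective {k} {l} e = toℕ-injective (+-cancelʳ-≡ a (toℕ k) (toℕ l)
    (trans (sym (toℕ-at k)) (trans (cong toℕ e) (toℕ-at l))))

  at-∼ : ∀ {k l} → k ∼ l → at k ∼ at l
  at-∼ {k} {l} = Sum.map (shift k l) (shift l k)
    where
    shift : ∀ k l → suc (toℕ k) ≡ toℕ l → suc (toℕ (at k)) ≡ toℕ (at l)
    shift k l e = trans (cong suc (toℕ-at k)) (trans (cong (_+ a) e) (sym (toℕ-at l)))

  mate-injective : ∀ {i j} → Outside i → Outside j → mate i ≡ mate j → i ≡ j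
  mate-injective oᵢ oⱼ e =
    trans (sym (mate-involutive oᵢ)) (trans (cong mate e) (mate-involutive oⱼ))

  inside? : ∀ i → Dec (∃ λ k → at k ≡ i)
  inside? i = any? λ k → at k ≟ᶠ i

suc-∼ : ∀ {n} (i j : Fin n) → i ∼ j → Fin.suc i ∼ suc j
suc-∼ i j = Sum.map (cong suc) (cong suc)

empty : Window 0 0 0
empty = record
  { at = λ () ; toℕ-at = λ () ; mate = λ ()
  ; mate-∼ = λ { {()} } ; mate-outside = λ { {()} } ; mate-involutive = λ { {()} }
  }

-- The starting point of an interval without vertices is arbitrary.
restart : ∀ {n a} → Window 0 n a → Window 0 n 0
restart W = record
  { at = at ; toℕ-at = λ () ; mate = mate
  ; mate-∼ = mate-∼ ; mate-outside = mate-outside ; mate-involutive = mate-involutive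
  }
  where open Window W

-- A new first vertex, inside the interval.
extend : ∀ {w n} → Window w n 0 → Window (suc w) (suc n) 0
extend {w} {n} W = record
  { at              = at′
  ; toℕ-at          = λ { zero → refl ; (suc k) → cong suc (toℕ-at k) }
  ; mate            = mate′
  ; mate-∼          = λ { {zero} o → contradiction refl (o zero)
                        ; {suc i} o → suc-∼ i (mate i) (mate-∼ (tail o)) }
  ; mate-outside    = λ { {zero} o → contradiction refl (o zero)
                        ; {suc i} o (suc k) e → mate-outside (tail o) k (suc-injective e) }
  ; mate-involutive = λ { {zero} o → refl ; {suc i} o → cong suc (mate-involutive (tail o)) }
  }
  where
  open Window W

  at′ : Fin (suc w) → Fin (suc n)
  at′ zero    = zero
  at′ (suc k) = suc (at k)

  mate′ : Fin (suc n) → Fin (suc n)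
  mate′ zero    = zero
  mate′ (suc i) = suc (mate i)

  tail : ∀ {i} → (∀ k → at′ k ≢ suc i) → Outside i
  tail o k e = o (suc k) (cong suc e)

-- Two new first vertices, outside the interval and matched with each other.
pad : ∀ {w n a} → Window w n a → Window w (2 + n) (2 + a)
pad {w} {n} {a} W = record
  { at              = λ k → suc (suc (at k))
  ; toℕ-at          = λ k → trans (cong (2 +_) (toℕ-at k))
                        (sym (trans (+-suc (toℕ k) (suc a)) (cong suc (+-suc (toℕ k) a))))
  ; mate            = mate′
  ; mate-∼          = λ { {zero} o → inj₁ refl
                        ; {suc zero} o → inj₂ refl
                        ; {suc (suc i)} o → suc-∼ (suc i) (suc (mate i))
                            (suc-∼ i (mate i) (mate-∼ (drop₂ o))) }
  ; mate-outside    = λ { {zero} o k () ; {suc zero} o k ()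
                        ; {suc (suc i)} o k e →
                            mate-outside (drop₂ o) k (suc-injective (suc-injective e)) }
  ; mate-involutive = λ { {zero} o → refl
                        ; {suc zero} o → refl
                        ; {suc (suc i)} o → cong (λ x → suc (suc x)) (mate-involutive (drop₂ o)) }
  }
  where
  open Window W

  mate′ : Fin (2 + n) → Fin (2 + n)
  mate′ zero          = suc zero
  mate′ (suc zero)    = zero
  mate′ (suc (suc i)) = suc (suc (mate i))

  drop₂ : ∀ {i} → (∀ k → suc (suc (at k)) ≢ suc (suc i)) → Outside i
  drop₂ o k e = o k (cong (λ x → suc (suc x)) e)

parity-pred : ∀ m n → parity (suc m) ≡ parity (suc n) → parity m ≡ parity n
parity-pred m n e = trans (sym (suc-homo-⁻¹ m)) (trans (cong _⁻¹ e) (suc-homo-⁻¹ n))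

-- The bound suc n in place of n is no weaker, since w and n have the same
-- parity.
window : ∀ k w n → parity w ≡ parity n → w + k * 2 ≤ suc n → Window w n (k * 2)
window zero    zero          zero          e  b       = empty
window zero    zero          (suc (suc n)) e  b       = restart (pad (window 0 0 n e z≤n))
window zero    (suc zero)    zero          () b
window zero    (suc (suc w)) zero          e  (s≤s ())
window zero    (suc w)       (suc n)       e  (s≤s b) = extend (window 0 w n (parity-pred w n e) b)
window (suc k) w             n             e  b
  with n | e | subst (_≤ suc n) (trans (+-suc w (suc (k * 2))) (cong suc (+-suc w (k * 2)))) b
... | zero        | _  | s≤s ()
... | suc zero    | e′ | s≤s (s≤s b′) = contradiction e′ (impossible w b′)
  where
  impossible : ∀ w → w + k * 2 ≤ 0 → parity w ≢ 1ℙ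
  impossible zero _ ()
... | suc (suc n) | e′ | s≤s (s≤s b′) = pad (window k w n e′ b′)

-- Extending a pairing from a window to the grid

module _ {m n h w a b} (R : Window h m a) (C : Window w n b) where
  private
    module R = Window R
    module C = Window C

  at₂ : Cell h w → Cell m n
  at₂ (k , l) = R.at k , C.at l

  at₂-— : ∀ {p q} → p — q → at₂ p — at₂ q
  at₂-— (inj₁ (e , s)) = inj₁ (cong R.at e , C.at-∼ s)
  at₂-— (inj₂ (e , s)) = inj₂ (cong C.at e , R.at-∼ s)

  at₂-injective : ∀ {p q} → at₂ p ≡ at₂ q → p ≡ q
  at₂-injective e = cong₂ _,_ (R.at-injective (cong proj₁ e)) (C.at-injective (cong proj₂ e))

  module _ {u v : Cell h w} (P : Pairing (Only u v)) where

    -- The graph of the extended pairing: rows outside the window are matched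
    -- with one another, then columns outside the window within the remaining
    -- rows, and P is used on the window itself.
    data Paired : Cell m n → Cell m n → Set where
      vertical   : ∀ {i j} → R.Outside i → Paired (i , j) (R.mate i , j)
      horizontal : ∀ k {j} → C.Outside j → Paired (R.at k , j) (R.at k , C.mate j)
      interior   : ∀ p → Paired (at₂ p) (at₂ (partner P p))

    paired : ∀ p → ∃ (Paired p)
    paired (i , j) with R.inside? i | C.inside? j
    ... | no  ∄k         | _              = _ , vertical λ k e → ∄k (k , e)
    ... | yes (k , refl) | no  ∄l         = _ , horizontal k λ l e → ∄l (l , e)
    ... | yes (k , refl) | yes (l , refl) = _ , interior (k , l)

    paired-— : ∀ {p p′} → Paired p p′ → p — p′
    paired-— (vertical o)     = inj₂ (refl , R.mate-∼ o)
    paired-— (horizontal k o) = inj₁ (refl , C.mate-∼ o)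
    paired-— (interior p)     = at₂-— (adjacent P p)

    paired-injective : ∀ {p p′ q q′} → Paired p p′ → Paired q q′ → p′ ≡ q′ →
                       p ≡ q ⊎ Only (at₂ u) (at₂ v) p q
    paired-injective (vertical o) (vertical o′) e =
      inj₁ (cong₂ _,_ (R.mate-injective o o′ (cong proj₁ e)) (cong proj₂ e))
    paired-injective (horizontal _ o) (horizontal _ o′) e =
      inj₁ (cong₂ _,_ (cong proj₁ e) (C.mate-injective o o′ (cong proj₂ e)))
    paired-injective (interior p) (interior q) e =
      Sum.map (cong at₂) (map-Only at₂) (injective P p q (at₂-injective e))
    paired-injective (vertical o) (horizontal k _) e =
      contradiction (sym (cong proj₁ e)) (R.mate-outside o k)
    paired-injective (vertical o) (interior _) e =
      contradiction (sym (cong proj₁ e)) (R.mate-outside o _)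
    paired-injective (horizontal k _) (vertical o) e =
      contradiction (cong proj₁ e) (R.mate-outside o k)
    paired-injective (horizontal _ o) (interior _) e =
      contradiction (sym (cong proj₂ e)) (C.mate-outside o _)
    paired-injective (interior _) (vertical o) e =
      contradiction (cong proj₁ e) (R.mate-outside o _)
    paired-injective (interior _) (horizontal _ o) e =
      contradiction (cong proj₂ e) (C.mate-outside o _)

    frame : Pairing (Only (at₂ u) (at₂ v))
    frame = record
      { partner   = proj₁ ∘ paired
      ; adjacent  = λ p → paired-— (proj₂ (paired p))
      ; injective = λ p q → paired-injective (proj₂ (paired p)) (proj₂ (paired q))
      }

-- Explicit pairings of small rectangles

data Arrow : Set where
  ↑ ↓ ← ⇢ : Arrow

-- A pairing drawn as a table of arrows from each cell to its partner; row 0 is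
-- at the top.
Picture : ℕ → ℕ → Set
Picture m n = Vec (Vec Arrow n) m

-- Like pred, next stays put at the end of the range.
next : ∀ {n} → Fin n → Fin n
next {suc zero}    zero    = zero
next {suc (suc n)} zero    = suc zero
next               (suc i) = suc (next i)

move : ∀ {m n} → Arrow → Cell m n → Cell m n
move ↑ (i , j) = pred i , j
move ↓ (i , j) = next i , j
move ← (i , j) = i , pred j
move ⇢ (i , j) = i , next j

follow : ∀ {m n} → Picture m n → Cell m n → Cell m n
follow t (i , j) = move (lookup (lookup t i) j) (i , j)

allCells? : ∀ {m n} {P : Cell m n → Set} → (∀ p → Dec (P p)) → Dec (∀ i j → P (i , j))
allCells? P? = all? λ i → all? λ j → P? (i , j)

Valid : ∀ {m n} → Picture m n → Cell m n → Cell m n → Set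
Valid t u v =
  (∀ i j → (i , j) — follow t (i , j)) ×
  (∀ i j k l → follow t (i , j) ≡ follow t (k , l) →
     (i , j) ≡ (k , l) ⊎ Only u v (i , j) (k , l))

valid? : ∀ {m n} (t : Picture m n) u v → Dec (Valid t u v)
valid? t u v =
  allCells? (λ p → p —? follow t p) ×-dec
  allCells? λ p → allCells? λ q →
    (follow t p ≟ᶜ follow t q) →-dec ((p ≟ᶜ q) ⊎-dec only? u v p q)

fromPicture : ∀ {m n} (t : Picture m n) u v {_ : True (valid? t u v)} → Pairing (Only u v)
fromPicture t u v {valid} = record
  { partner   = follow t
  ; adjacent  = λ (i , j) → proj₁ (toWitness valid) i j
  ; injective = λ (i , j) (k , l) → proj₂ (toWitness valid) i j k l
  }

-- Each of these is named for the directions from σ to u and to v.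

leftRight : Pairing {1} {3} (Only (0F , 0F) (0F , 2F))
leftRight = fromPicture
  ( (⇢ ∷ ← ∷ ← ∷ []) ∷ []) _ _

leftDown : Pairing {3} {3} (Only (0F , 0F) (1F , 1F))
leftDown = fromPicture
  ( (⇢ ∷ ← ∷ ↓ ∷ [])
  ∷ (↓ ∷ ↑ ∷ ↑ ∷ [])
  ∷ (↑ ∷ ⇢ ∷ ← ∷ []) ∷ []) _ _

rightDown : Pairing {3} {3} (Only (0F , 2F) (1F , 1F))
rightDown = fromPicture
  ( (↓ ∷ ⇢ ∷ ← ∷ [])
  ∷ (↑ ∷ ↑ ∷ ↓ ∷ [])
  ∷ (⇢ ∷ ← ∷ ↑ ∷ []) ∷ []) _ _

leftUp : Pairing {3} {3} (Only (2F , 0F) (1F , 1F))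
leftUp = fromPicture
  ( (↓ ∷ ⇢ ∷ ← ∷ [])
  ∷ (↑ ∷ ↓ ∷ ↓ ∷ [])
  ∷ (⇢ ∷ ← ∷ ↑ ∷ []) ∷ []) _ _

rightUp : Pairing {3} {3} (Only (2F , 2F) (1F , 1F))
rightUp = fromPicture
  ( (⇢ ∷ ← ∷ ↓ ∷ [])
  ∷ (↓ ∷ ↓ ∷ ↑ ∷ [])
  ∷ (↑ ∷ ⇢ ∷ ← ∷ []) ∷ []) _ _

upDown : Pairing {5} {3} (Only (1F , 1F) (3F , 1F))
upDown = fromPicture
  ( (⇢ ∷ ← ∷ ↓ ∷ [])
  ∷ (↓ ∷ ↓ ∷ ↑ ∷ [])
  ∷ (↑ ∷ ↑ ∷ ↓ ∷ [])
  ∷ (↓ ∷ ↑ ∷ ↑ ∷ [])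
  ∷ (↑ ∷ ⇢ ∷ ← ∷ []) ∷ []) _ _

-- Two cells sharing a partner in a grid with odd sides

At : ∀ {m n} → Cell m n → ℕ → ℕ → Set
At (i , j) x y = toℕ i ≡ x × toℕ j ≡ y

At-unique : ∀ {m n} {p q : Cell m n} {x y} → At p x y → At q x y → p ≡ q
At-unique (e , f) (e′ , f′) =
  cong₂ _,_ (toℕ-injective (trans e (sym e′))) (toℕ-injective (trans f (sym f′)))

-- frame, with the positions of u and v in the grid given by coordinates.
fit : ∀ {m n h w a b} → Window h m a → Window w n b →
      ∀ {u₀ v₀ : Cell h w} → Pairing (Only u₀ v₀) → ∀ {u v : Cell m n} →
      At u (toℕ (proj₁ u₀) + a) (toℕ (proj₂ u₀) + b) →
      At v (toℕ (proj₁ v₀) + a) (toℕ (proj₂ v₀) + b) → Pairing (Only u v)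
fit {a = a} {b} R C {u₀} {v₀} P at-u at-v =
  subst₂ (λ u v → Pairing (Only u v))
    (At-unique (at-at₂ u₀) at-u) (At-unique (at-at₂ v₀) at-v) (frame R C P)
  where
  at-at₂ : ∀ p → At (at₂ R C p) (toℕ (proj₁ p) + a) (toℕ (proj₂ p) + b)
  at-at₂ (k , l) = Window.toℕ-at R k , Window.toℕ-at C l

-- The position of u relative to the cell in row 2a and column 1 + 2b, to which
-- it is adjacent.
data Neighbour {m n} (u : Cell m n) : ℕ → ℕ → Set where
  left  : ∀ {a b} → At u (a * 2) (b * 2)         → Neighbour u a b
  right : ∀ {a b} → At u (a * 2) (2 + b * 2)     → Neighbour u a b
  down  : ∀ {a b} → At u (1 + a * 2) (1 + b * 2) → Neighbour u a b
  up    : ∀ {a b} → At u (1 + a * 2) (1 + b * 2) → Neighbour u (suc a) b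

neighbour : ∀ {m n} {σ u : Cell m n} a b → At σ (a * 2) (1 + b * 2) → σ — u → Neighbour u a b
neighbour a       b (e , f) (inj₁ (refl , inj₁ g)) = right (e , trans (sym g) (cong suc f))
neighbour a       b (e , f) (inj₁ (refl , inj₂ g)) = left (e , suc-injectiveℕ (trans g f))
neighbour a       b (e , f) (inj₂ (refl , inj₁ g)) = down (trans (sym g) (cong suc e) , f)
neighbour zero    b (e , f) (inj₂ (refl , inj₂ g)) = contradiction (trans g e) λ ()
neighbour (suc a) b (e , f) (inj₂ (refl , inj₂ g)) = up (suc-injectiveℕ (trans g e) , f)

toℕ≡⇒< : ∀ {n x} (i : Fin n) → toℕ i ≡ x → suc x ≤ n
toℕ≡⇒< i refl = toℕ<n i

module _ {m n} (m-odd : parity m ≡ 1ℙ) (n-odd : parity n ≡ 1ℙ) where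

  pairing-oddCell : ∀ {σ u v : Cell m n} a b → At σ (a * 2) (1 + b * 2) →
                    Neighbour u a b → Neighbour v a b → u ≢ v → Pairing (Only u v)
  pairing-oddCell {i , j} {u} {v} a b (e , f) = cases a e
    where
    columns : Window 3 n (b * 2)
    columns = window b 3 n (sym n-odd) (s≤s (toℕ≡⇒< j f))

    -- In each case the bound comes from the lowest of the rows of u, σ and v.
    rows₁ : ∀ a → toℕ i ≡ a * 2 → Window 1 m (a * 2)
    rows₁ a e = window a 1 m (sym m-odd) (≤-trans (toℕ≡⇒< i e) (n≤1+n m))

    rows-down : ∀ a {k : Fin m} → toℕ k ≡ 1 + a * 2 → Window 3 m (a * 2)
    rows-down a {k} e = window a 3 m (sym m-odd) (s≤s (toℕ≡⇒< k e))

    rows-up : ∀ a → toℕ i ≡ suc a * 2 → Window 3 m (a * 2)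
    rows-up a e = window a 3 m (sym m-odd) (≤-trans (toℕ≡⇒< i e) (n≤1+n m))

    rows₅ : ∀ a {k : Fin m} → toℕ k ≡ 3 + a * 2 → Window 5 m (a * 2)
    rows₅ a {k} e = window a 5 m (sym m-odd) (s≤s (toℕ≡⇒< k e))

    flip : ∀ {u v : Cell m n} → Pairing (Only u v) → Pairing (Only v u)
    flip = weaken Sum.swap

    cases : ∀ a → toℕ i ≡ a * 2 → Neighbour u a b → Neighbour v a b → u ≢ v → Pairing (Only u v)
    cases a       e (left  p) (left  q) u≢v = contradiction (At-unique p q) u≢v
    cases a       e (right p) (right q) u≢v = contradiction (At-unique p q) u≢v
    cases a       e (down  p) (down  q) u≢v = contradiction (At-unique p q) u≢v
    cases (suc a) e (up    p) (up    q) u≢v = contradiction (At-unique p q) u≢v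
    cases a       e (left  p) (right q) _   = fit (rows₁ a e) columns leftRight p q
    cases a       e (right p) (left  q) _   = flip (fit (rows₁ a e) columns leftRight q p)
    cases a       e (left  p) (down  q) _   = fit (rows-down a (proj₁ q)) columns leftDown p q
    cases a       e (down  p) (left  q) _   = flip (fit (rows-down a (proj₁ p)) columns leftDown q p)
    cases a       e (right p) (down  q) _   = fit (rows-down a (proj₁ q)) columns rightDown p q
    cases a       e (down  p) (right q) _   = flip (fit (rows-down a (proj₁ p)) columns rightDown q p)
    cases (suc a) e (left  p) (up    q) _   = fit (rows-up a e) columns leftUp p q
    cases (suc a) e (up    p) (left  q) _   = flip (fit (rows-up a e) columns leftUp q p)
    cases (suc a) e (right p) (up    q) _   = fit (rows-up a e) columns rightUp p q
    cases (suc a) e (up    p) (right q) _   = flip (fit (rows-up a e) columns rightUp q p)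
    cases (suc a) e (up    p) (down  q) _   = fit (rows₅ a (proj₁ q)) columns upDown p q
    cases (suc a) e (down  p) (up    q) _   = flip (fit (rows₅ a (proj₁ p)) columns upDown q p)

half : ∀ n → (parity n ≡ 0ℙ × ∃ λ k → n ≡ k * 2) ⊎ (parity n ≡ 1ℙ × ∃ λ k → n ≡ 1 + k * 2)
half zero          = inj₁ (refl , zero , refl)
half (suc zero)    = inj₂ (refl , zero , refl)
half (suc (suc n)) =
  Sum.map (Product.map₂ (Product.map suc (cong (2 +_))))
          (Product.map₂ (Product.map suc (cong (2 +_)))) (half n)

-- The chessboard colouring.
shade : ∀ {m n} → Cell m n → Parity
shade (i , j) = parity (toℕ i) ℙ.+ parity (toℕ j)

pairing-odd : ∀ {m n} → parity m ≡ 1ℙ → parity n ≡ 1ℙ → ∀ {σ u v : Cell m n} → shade σ ≡ 1ℙ →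
              σ — u → σ — v → u ≢ v → Pairing (Only u v)
pairing-odd m-odd n-odd {i , j} {u} {v} σ-odd σu σv u≢v with half (toℕ i) | half (toℕ j)
... | inj₁ (_ , a , e) | inj₂ (_ , b , f) =
  pairing-oddCell m-odd n-odd a b (e , f)
    (neighbour a b (e , f) σu) (neighbour a b (e , f) σv) u≢v
... | inj₂ (_ , a , e) | inj₁ (_ , b , f) =
  weaken (map-Only Product.swap)
    (transpose (pairing-oddCell n-odd m-odd b a (f , e)
      (neighbour b a (f , e) (swap-— σu)) (neighbour b a (f , e) (swap-— σv))
      (u≢v ∘ cong Product.swap)))
... | inj₁ (e , _) | inj₁ (f , _) = contradiction (trans (sym (cong₂ ℙ._+_ e f)) σ-odd) λ ()
... | inj₂ (e , _) | inj₂ (f , _) = contradiction (trans (sym (cong₂ ℙ._+_ e f)) σ-odd) λ ()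

-- Grids with an even side

data Never {A : Set} : Rel A 0ℓ where

pairing-evenRows : ∀ {m n} → parity m ≡ 0ℙ → Pairing {m} {n} Never
pairing-evenRows {m} m-even = record
  { partner   = λ (i , j) → mate i , j
  ; adjacent  = λ _ → inj₂ (refl , mate-∼ λ ())
  ; injective = λ _ _ e →
      inj₁ (cong₂ _,_ (mate-injective (λ ()) (λ ()) (cong proj₁ e)) (cong proj₂ e))
  }
  where open Window (window 0 0 m (sym m-even) z≤n)

-- From pairings to list colourings

remQuot-injective : ∀ {m} n {x y : Fin (m * n)} → remQuot {m} n x ≡ remQuot {m} n y → x ≡ y
remQuot-injective {m} n {x} {y} e =
  trans (sym (combine-remQuot {m} n x)) (trans (cong (uncurry combine) e) (combine-remQuot {m} n y))

colour : ∀ {m n} {Share : Rel (Cell m n) 0ℓ} → Pairing Share → (H : Graph (m * n)) →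
         (∀ x y → Share (remQuot n x) (remQuot n y) → ¬ Graph._~_ H x y) →
         Colorable H (neighborhood (path m □ path n))
colour {m} {n} P H free = φ , φ-∈ , φ-proper
  where
  cell : Fin (m * n) → Cell m n
  cell = remQuot n

  φ : Fin (m * n) → Fin (m * n)
  φ x = uncurry combine (partner P (cell x))

  cell-φ : ∀ x → cell (φ x) ≡ partner P (cell x)
  cell-φ x = remQuot-combine _ _

  φ-∈ : ∀ x → φ x ∈ neighborhood (path m □ path n) x
  φ-∈ x = lookup⇒[]= _ _ (trans (lookup∘tabulate _ (φ x))
    (dec-true (Graph._~?_ (path m □ path n) x (φ x))
      (subst (cell x —_) (sym (cell-φ x)) (adjacent P (cell x)))))

  φ-proper : ∀ x y → Graph._~_ H x y → φ x ≢ φ y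
  φ-proper x y xy e
    with injective P (cell x) (cell y) (trans (sym (cell-φ x)) (trans (cong cell e) (cell-φ y)))
  ... | inj₁ same  = Graph.~-irrefl H (remQuot-injective {m} n same) xy
  ... | inj₂ share = free x y share xy

-- Hall's condition on the even vertices

induced : ∀ {n} (H : Graph n) → Subset n → Subgraph H
induced H S = record
  { vertices  = S
  ; _~_       = λ u v → u ~ v × u ∈ S × v ∈ S
  ; _~?_      = λ u v → (u ~? v) ×-dec (u ∈? S) ×-dec (v ∈? S)
  ; ~-sym     = λ (uv , u∈S , v∈S) → ~-sym uv , v∈S , u∈S
  ; ~⇒H       = proj₁
  ; endpoints = proj₂
  }
  where open Graph H

α≤ : ∀ {n s} {H : Graph n} (F : Subgraph H) (L : Lists n s) σ {b} →
     (∀ X → Independent F X → AllAllow F L σ X → ∣ X ∣ ≤ b) → α F L σ ≤ b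
α≤ F L σ bound
  with s≤s α≤b ← max<v⁺ (s≤s z≤n) (All.map⁺ (All.map (λ (ind , allow) → s≤s (bound _ ind allow))
         (All.all-filter (λ X → independent? F X ×-dec allAllow? F L σ X) (subsets _)))) = α≤b

none⇒∣p∣≤0 : ∀ {n} (p : Subset n) → (∀ {x} → ¬ x ∈ p) → ∣ p ∣ ≤ 0
none⇒∣p∣≤0 {n} p none =
  ≤-reflexive (trans (cong ∣_∣ (Empty-unique λ (x , x∈p) → none x∈p)) (∣⊥∣≡0 n))

unique⇒∣p∣≤1 : ∀ {n} (p : Subset n) → (∀ {x y} → x ∈ p → y ∈ p → x ≡ y) → ∣ p ∣ ≤ 1
unique⇒∣p∣≤1 p unique with nonempty? p
... | yes (x , x∈p) = ≤-trans
        (p⊆q⇒∣p∣≤∣q∣ λ y∈p → subst (_∈ ⁅ x ⁆) (unique x∈p y∈p) (x∈⁅x⁆ x))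
        (≤-reflexive (∣⁅x⁆∣≡1 x))
... | no  ∄x        = ≤-trans (none⇒∣p∣≤0 p λ {x} x∈p → ∄x (x , x∈p)) z≤n

sum-mono : ∀ {n} {f g : Fin n → ℕ} → (∀ i → f i ≤ g i) → sum f ≤ sum g
sum-mono {zero}  f≤g = z≤n
sum-mono {suc n} f≤g = +-mono-≤ (f≤g zero) (sum-mono (f≤g ∘ suc))

isEven : Parity → Bool
isEven 0ℙ = inside
isEven 1ℙ = outside

evens : ∀ n → Subset n
evens n = tabulate (isEven ∘ parity ∘ toℕ)

∈-evens⁻ : ∀ {n} {x : Fin n} → x ∈ evens n → parity (toℕ x) ≡ 0ℙ
∈-evens⁻ {x = x} x∈ with parity (toℕ x) | trans (sym (lookup∘tabulate _ x)) ([]=⇒lookup x∈)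
... | 0ℙ | _ = refl
... | 1ℙ | ()

-- The indicator of the odd parity.
oddity : Parity → ℕ
oddity 0ℙ = 0
oddity 1ℙ = 1

∣evens∣ : ∀ n → parity n ≡ 1ℙ → ∣ evens n ∣ ≡ suc (sum {n} (λ x → oddity (parity (toℕ x))))
∣evens∣ (suc zero)    _ = refl
∣evens∣ (suc (suc n)) e = cong suc (∣evens∣ n e)

∈-neighborhood⁻ : ∀ {n} (G : Graph n) {u v} → u ∈ neighborhood G v → Graph._~_ G v u
∈-neighborhood⁻ G {u} {v} u∈
  with Graph._~?_ G v u | trans (sym (lookup∘tabulate _ u)) ([]=⇒lookup u∈)
... | yes vu | _  = vu
... | no  _  | ()

-- The counting step, for any graph G on an odd number of vertices whose edges
-- join vertices of opposite parity.
module _ {n} (G H : Graph n) (n-odd : parity n ≡ 1ℙ)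
  (alternating : ∀ {u v} → Graph._~_ G u v → parity (toℕ v) ≢ parity (toℕ u)) where
  private
    module G = Graph G
    module H = Graph H

  -- σ can be given to both u and v, in G and in H.
  Witness : Fin n → Fin n → Fin n → Set
  Witness σ u v = parity (toℕ σ) ≡ 1ℙ × u ≢ v × σ G.~ u × σ G.~ v × ¬ (u H.~ v)

  hall-witness : HallCondition H (neighborhood G) → ∃ λ σ → ∃ λ u → ∃ λ v → Witness σ u v
  hall-witness hall with any? (λ σ → any? λ u → any? λ v →
    (parity (toℕ σ) ≟ℙ 1ℙ) ×-dec ¬? (u ≟ᶠ v) ×-dec (σ G.~? u) ×-dec (σ G.~? v) ×-dec ¬? (u H.~? v))
  ... | yes w  = w
  ... | no  ∄w = contradiction
          (≤-trans (≤-reflexive (sym (∣evens∣ n n-odd))) (≤-trans (hall F) (sum-mono {n} α≤oddity)))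
          (≤⇒≯ ≤-refl)
    where
    F : Subgraph H
    F = induced H (evens n)

    small : ∀ σ p → parity (toℕ σ) ≡ p → ∀ X → Independent F X →
            AllAllow F (neighborhood G) σ X → ∣ X ∣ ≤ oddity p
    small σ 0ℙ σ-even X (X⊆ , _) allow = none⇒∣p∣≤0 X λ x∈X →
      alternating (∈-neighborhood⁻ G (allow _ x∈X)) (trans σ-even (sym (∈-evens⁻ (X⊆ x∈X))))
    small σ 1ℙ σ-odd X (X⊆ , ind) allow = unique⇒∣p∣≤1 X λ {x} {y} x∈X y∈X →
      decidable-stable (x ≟ᶠ y) λ x≢y → ∄w (σ , x , y , σ-odd , x≢y ,
        G.~-sym (∈-neighborhood⁻ G (allow x x∈X)) , G.~-sym (∈-neighborhood⁻ G (allow y y∈X)) ,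
        λ xy → ind x y x∈X y∈X (xy , X⊆ x∈X , X⊆ y∈X))

    α≤oddity : ∀ σ → α F (neighborhood G) σ ≤ oddity (parity (toℕ σ))
    α≤oddity σ = α≤ F (neighborhood G) σ (small σ _ refl)

-- The shade of a cell as the parity of a vertex

∼-parity : ∀ {n} (i j : Fin n) → i ∼ j → parity (toℕ j) ≡ parity (toℕ i) ⁻¹
∼-parity i j (inj₁ e) = trans (cong parity (sym e)) (sym (⁻¹-selfInverse (suc-homo-⁻¹ (toℕ i))))
∼-parity i j (inj₂ e) = trans (sym (suc-homo-⁻¹ (toℕ j))) (cong (_⁻¹ ∘ parity) e)

+-⁻¹-≢ : ∀ p q → p ℙ.+ q ⁻¹ ≢ p ℙ.+ q
+-⁻¹-≢ 0ℙ 0ℙ ()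
+-⁻¹-≢ 0ℙ 1ℙ ()
+-⁻¹-≢ 1ℙ 0ℙ ()
+-⁻¹-≢ 1ℙ 1ℙ ()

⁻¹-+-≢ : ∀ p q → p ⁻¹ ℙ.+ q ≢ p ℙ.+ q
⁻¹-+-≢ 0ℙ 0ℙ ()
⁻¹-+-≢ 0ℙ 1ℙ ()
⁻¹-+-≢ 1ℙ 0ℙ ()
⁻¹-+-≢ 1ℙ 1ℙ ()

shade-— : ∀ {m n} {p q : Cell m n} → p — q → shade q ≢ shade p
shade-— {p = i , j} {k , l} (inj₁ (refl , j∼l)) rewrite ∼-parity j l j∼l =
  +-⁻¹-≢ (parity (toℕ i)) (parity (toℕ j))
shade-— {p = i , j} {k , l} (inj₂ (refl , i∼k)) rewrite ∼-parity i k i∼k =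
  ⁻¹-+-≢ (parity (toℕ i)) (parity (toℕ j))

-- As n is odd, the index n * i + j has the parity of i + j.
parity≡shade : ∀ m n → parity n ≡ 1ℙ → (x : Fin (m * n)) →
               parity (toℕ x) ≡ shade (remQuot {m} n x)
parity≡shade m n n-odd x = begin
  parity (toℕ x)
    ≡⟨ cong (parity ∘ toℕ) (combine-remQuot {m} n x) ⟨
  parity (toℕ (combine i j))
    ≡⟨ cong parity (toℕ-combine i j) ⟩
  parity (n * toℕ i + toℕ j)
    ≡⟨ +-homo-+ (n * toℕ i) (toℕ j) ⟩
  parity (n * toℕ i) ℙ.+ parity (toℕ j)
    ≡⟨ cong (ℙ._+ parity (toℕ j)) (*-homo-* n (toℕ i)) ⟩
  parity n ℙ.* parity (toℕ i) ℙ.+ parity (toℕ j)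
    ≡⟨ cong (λ p → p ℙ.* parity (toℕ i) ℙ.+ parity (toℕ j)) n-odd ⟩
  parity (toℕ i) ℙ.+ parity (toℕ j) ∎
  where
  open ≡-Reasoning
  i = proj₁ (remQuot {m} n x)
  j = proj₂ (remQuot {m} n x)

theorem4p18 : ∀ (m n : ℕ) → m ≥ 1 → n ≥ 1 → HallUniversal (path m □ path n)
theorem4p18 m n _ _ H hall with parity m in m-parity | parity n in n-parity
... | 0ℙ | _  = colour {m} {n} (pairing-evenRows m-parity) H λ _ _ ()
... | 1ℙ | 0ℙ = colour {m} {n} (transpose (pairing-evenRows n-parity)) H λ _ _ ()
... | 1ℙ | 1ℙ =
  let σ , u , v , σ-odd , u≢v , σu , σv , ¬uv = hall-witness (path m □ path n) H mn-odd alternating hall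
  in colour {m} {n}
       (pairing-odd m-parity n-parity (trans (sym (parity≡shade m n n-parity σ)) σ-odd) σu σv
         (u≢v ∘ remQuot-injective {m} n))
       H (free u v ¬uv)
  where
  mn-odd : parity (m * n) ≡ 1ℙ
  mn-odd = trans (*-homo-* m n) (cong₂ ℙ._*_ m-parity n-parity)

  alternating : ∀ {x y} → Graph._~_ (path m □ path n) x y → parity (toℕ y) ≢ parity (toℕ x)
  alternating {x} {y} xy e = shade-— xy
    (trans (sym (parity≡shade m n n-parity y)) (trans e (parity≡shade m n n-parity x)))

  free : ∀ u v → ¬ Graph._~_ H u v → ∀ x y →
         Only (remQuot {m} n u) (remQuot {m} n v) (remQuot {m} n x) (remQuot {m} n y) →
         ¬ Graph._~_ H x y
  free u v ¬uv x y (inj₁ (e , f)) xy =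
    ¬uv (subst₂ (Graph._~_ H) (remQuot-injective {m} n e) (remQuot-injective {m} n f) xy)
  free u v ¬uv x y (inj₂ (e , f)) xy =
    ¬uv (Graph.~-sym H (subst₂ (Graph._~_ H) (remQuot-injective {m} n e) (remQuot-injective {m} n f) xy))
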